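{- Let $n\in\{5,6,7\}$ and let $g$ be a positive integer such that $gn\equiv 0 \pmod 2$, $g(n-1)(n-2)\equiv 0\pmod 3$, and $(n,g)\neq(5,2)$. Then a large set of H-designs LH$(n,g,4,3)$ exists, with possible exceptions when $n=5$ and $g\equiv 2\pmod 4$.
   Context: An H-design H$(n,g,k,t)$ is a triple $(Q,G,B)$ where $Q$ is a set of $ng$ points, $G$ is a partition of $Q$ into $n$ groups of size $g$, and $B$ is a set of $k$-subsets of $Q$ (blocks) such that each block meets each group in at most one point and any $t$ points from $t$ distinct groups lie in exactly one block. A large set of H-designs LH$(n,g,k,t)$ is a partition of the set of all $k$-subsets of $Q$ meeting each group of $G$ in at most one point into pairwise disjoint block sets, each of which forms (with $Q$ and $G$) an H-design H$(n,g,k,t)$. (The paper calls parameters "admissible" when they satisfy the known necessary and sufficient conditions for existence of an H$(n,g,4,3)$: $gn\equiv0 \pmod 2$, $g(n-1)(n-2)\equiv 0\pmod 3$, $n\ge 4$, $(n,g)\ne(5,2)$.) -}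

module Defs where

open import Data.Fin using (Fin)
open import Data.Fin.Subset using (Subset; _∈_; _⊆_; _∩_; ∣_∣)
open import Data.Nat using (ℕ; _*_; _≤_)
open import Data.Product using (_×_; ∃; ∃!)
open import Level using (Level; 0ℓ; _⊔_)
open import Relation.Binary.PropositionalEquality using (_≡_)
open import Relation.Unary as U using (Pred)

private
  variable
    i a ℓ₁ ℓ₂ : Level
    v n : ℕ

record IsPartition {I : Set i} {A : Set a} (S : Pred A ℓ₁) (C : I → Pred A ℓ₂)
                   : Set (i ⊔ a ⊔ ℓ₁ ⊔ ℓ₂) where
  field
    nonempty : ∀ j → U.Satisfiable (C j)
    included : ∀ j → C j U.⊆ S
    covering : ∀ {x} → S x → ∃ λ j → C j x
    disjoint : ∀ {j j′ x} → C j x → C j′ x → j ≡ j′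

IsGrouping : (g : ℕ) → (Fin n → Subset v) → Set
IsGrouping g G = IsPartition U.U (λ j x → x ∈ G j) × (∀ j → ∣ G j ∣ ≡ g)

-- For a grouping G, the m-subsets meeting each group in at most one point are
-- exactly the sets of m points from m distinct groups.
Transverse : (Fin n → Subset v) → ℕ → Pred (Subset v) 0ℓ
Transverse G m s = ∣ s ∣ ≡ m × (∀ j → ∣ s ∩ G j ∣ ≤ 1)

record IsHDesign (n g k t : ℕ) (G : Fin n → Subset (n * g))
                 (B : Pred (Subset (n * g)) 0ℓ) : Set where
  field
    grouping : IsGrouping g G
    blocks   : B U.⊆ Transverse G k
    balanced : ∀ {T} → Transverse G t T → ∃! _≡_ λ b → B b × T ⊆ b

record LH (n g k t : ℕ) : Set₁ where
  field
    groups    : Fin n → Subset (n * g)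
    grouping  : IsGrouping g groups
    size      : ℕ
    design    : Fin size → Pred (Subset (n * g)) 0ℓ
    partition : IsPartition (Transverse groups k) design
    isHDesign : ∀ j → IsHDesign n g k t groups (design j)

{-# OPTIONS --safe #-}

-- A k-subset meeting every group at most once is a partial choice of one point per
-- group.  Hence an LH(n,g,t+1,t) amounts to a colouring of the partial choices of
-- weight t+1 such that every colour occurs exactly once among the one-point
-- extensions of each partial choice of weight t.  Such a colouring for groups of
-- size g yields one for groups of size g h: identify a point with a pair (a , r),
-- r ∈ ℤ/h, and colour a partial choice by the colour of its a-parts together with the
-- sum of its r-parts.  The divisibility conditions force 4 ∣ g, 3 ∣ g, 2 ∣ g for
-- n = 5, 6, 7, so explicit colourings for (n , g) = (5 , 4), (6 , 3), (7 , 2) suffice.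
module Submission where

open import Defs
open import Data.Bool using (true; false)
open import Data.Fin as Fin
  using (Fin; zero; suc; toℕ; quotient; remainder; combine; remQuot)
open import Data.Fin.Properties as Fin
  using (toℕ-fromℕ<; toℕ-injective; toℕ<n; combine-remQuot; remQuot-combine)
open import Data.Fin.Subset
  using (Subset; inside; outside; _∈_; _⊆_; _∩_; ∣_∣; ⊥; ⊤; ⁅_⁆)
open import Data.Fin.Subset.Properties
  using (drop-∷-⊆; ∣⊤∣≡n; ∣⊥∣≡0; ∣⁅x⁆∣≡1; ∩-identityʳ; ∩-zeroʳ; ⊆-min; ⊆-refl;
         ⊆-reflexive; p⊆q⇒∣p∣≤∣q∣; x∈⁅x⁆; x∈⁅y⁆⇒x≡y; ∉⊥)
open import Data.List as List using (List; []; _∷_; allFin; filter; length)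
open import Data.List.Membership.Propositional as List using ()
open import Data.List.Membership.Propositional.Properties
  using (∈-++⁺ˡ; ∈-++⁺ʳ; ∈-++⁻; ∈-map⁺; ∈-map⁻; ∈-allFin; ∈-filter⁺; ∈-filter⁻)
open import Data.List.Relation.Unary.Any using (here)
open import Data.Maybe as Maybe using (Maybe; just; nothing; maybe)
open import Data.Maybe.Properties using (just-injective)
open import Data.Nat
  using (ℕ; zero; suc; _+_; _*_; _∸_; _^_; _/_; _%_; _≤_; _≥_; z≤n; s≤s; NonZero; >-nonZero)
open import Data.Nat.Combinatorics using (_C_)
open import Data.Nat.Divisibility using (_∣_; divides; _∣?_; m%n≡0⇒n∣m)
open import Data.Nat.DivMod
  using (_mod_; _divMod_; result; %-distribˡ-+; m%n%n≡m%n; [m+n]%n≡m%n; [m+kn]%n≡m%n;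
         m<n⇒m%n≡m; m%n<n)
open import Data.Nat.Primality using (Prime; prime?; prime[2]; euclidsLemma)
open import Data.Nat.Properties as ℕ
  using (+-comm; +-assoc; +-identityʳ; *-comm; *-assoc; m∸n+n≡m; m+[n∸m]≡n; <⇒≤; suc-injective;
         ≤-trans; ≤-reflexive; 1+n≰n; m^n≢0; m*n≢0⇒m≢0)
open import Data.Product using (_×_; _,_; proj₁; proj₂; ∃; ∃!)
open import Data.Sum using (_⊎_; inj₁; inj₂)
open import Data.Vec as Vec using (Vec; []; _∷_; _++_; here; there)
open import Data.Vec.Properties
  using (∷-injectiveˡ; ∷-injectiveʳ; lookup-++ˡ; lookup-++ʳ; lookup-replicate;
         lookup⇒[]=; []=⇒lookup; zipWith-++)
open import Function using (case_of_)
open import Relation.Binary.PropositionalEquality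
  using (_≡_; refl; sym; trans; cong; cong₂; subst; subst₂; module ≡-Reasoning)
open import Relation.Nullary using (¬_; Dec; does; yes; no; contradiction)
open import Relation.Nullary.Decidable
  using (map′; _×-dec_; _→-dec_; toWitness; from-yes; from-no; dec-true)
open import Relation.Unary using (Pred; Decidable)

private
  variable
    A : Set
    g k m n t : ℕ

-- Colourings of partial choices

Partial : Set → ℕ → Set
Partial A = Vec (Maybe A)

weight : Partial A n → ℕ
weight []            = 0
weight (nothing ∷ u) = weight u
weight (just _  ∷ u) = suc (weight u)

infix 4 _⋖_

-- The covering relation of the extension order. Its inductive form locates the one newly filled
-- group, so later proofs can match on that position.
data _⋖_ {A : Set} : Partial A n → Partial A n → Set where
  new  : ∀ {a} {u : Partial A n} → nothing ∷ u ⋖ just a ∷ u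
  keep : ∀ {x} {u v : Partial A n} → u ⋖ v → x ∷ u ⋖ x ∷ v

⋖⇒weight : {u v : Partial A n} → u ⋖ v → weight v ≡ suc (weight u)
⋖⇒weight new                      = refl
⋖⇒weight (keep {x = nothing} u⋖v) = ⋖⇒weight u⋖v
⋖⇒weight (keep {x = just _}  u⋖v) = cong suc (⋖⇒weight u⋖v)

-- Provides a starting choice whose extensions realise every colour of a balanced colouring, so that
-- no design is empty.
ofWeight : A → t ≤ n → ∃ λ (u : Partial A n) → weight u ≡ t
ofWeight {n = zero}  a z≤n       = [] , refl
ofWeight {n = suc n} a z≤n       with u , wu ← ofWeight {n = n} a z≤n = nothing ∷ u , wu
ofWeight             a (s≤s t≤n) with u , wu ← ofWeight a t≤n = just a ∷ u , cong suc wu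

-- Over `Fin g` a choice of weight `t` has `(n - t) * g` one-point extensions, which `c` matches
-- bijectively with the colours. In the base cases this forces 2 * 4 = 8, 3 * 3 = 9 and 4 * 2 = 8
-- colours.
Balanced : ℕ → (Partial A n → Fin k) → Set
Balanced t c = ∀ u → weight u ≡ t → ∀ i → ∃! _≡_ λ v → u ⋖ v × c v ≡ i

-- Addition modulo h

module _ {h : ℕ} .{{_ : NonZero h}} where

  infixl 6 _⊕_ _⊖_

  -- Since `toℕ b < h`, the truncated difference `h ∸ toℕ b` is exact and represents the negative of
  -- `b`.
  _⊕_ _⊖_ : Fin h → Fin h → Fin h
  a ⊕ b = (toℕ a + toℕ b) mod h
  a ⊖ b = (toℕ a + (h ∸ toℕ b)) mod h

  ⊕-comm : ∀ a b → a ⊕ b ≡ b ⊕ a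
  ⊕-comm a b = cong (_mod h) (+-comm (toℕ a) (toℕ b))

  toℕ-mod : ∀ m → toℕ (m mod h) ≡ m % h
  toℕ-mod m = toℕ-fromℕ< (m%n<n m h)

  mod-+ : ∀ m n → (toℕ (m mod h) + n) mod h ≡ (m + n) mod h
  mod-+ m n = toℕ-injective (begin
    toℕ ((toℕ (m mod h) + n) mod h)  ≡⟨ toℕ-mod _ ⟩
    (toℕ (m mod h) + n) % h          ≡⟨ cong (λ x → (x + n) % h) (toℕ-mod m) ⟩
    (m % h + n) % h                  ≡⟨ %-distribˡ-+ (m % h) n h ⟩
    (m % h % h + n % h) % h          ≡⟨ cong (λ x → (x + n % h) % h) (m%n%n≡m%n m h) ⟩
    (m % h + n % h) % h              ≡⟨ %-distribˡ-+ m n h ⟨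
    (m + n) % h                      ≡⟨ toℕ-mod _ ⟨
    toℕ ((m + n) mod h)              ∎)
    where open ≡-Reasoning

  toℕ+h-mod : ∀ a → (toℕ a + h) mod h ≡ a
  toℕ+h-mod a = toℕ-injective
    (trans (toℕ-mod _) (trans ([m+n]%n≡m%n (toℕ a) h) (m<n⇒m%n≡m (toℕ<n a))))

  ⊖-⊕ : ∀ a b → a ⊖ b ⊕ b ≡ a
  ⊖-⊕ a b = begin
    a ⊖ b ⊕ b                              ≡⟨ mod-+ _ (toℕ b) ⟩
    (toℕ a + (h ∸ toℕ b) + toℕ b) mod h    ≡⟨ cong (_mod h) (+-assoc (toℕ a) _ _) ⟩
    (toℕ a + (h ∸ toℕ b + toℕ b)) mod h    ≡⟨ cong (λ x → (toℕ a + x) mod h) (m∸n+n≡m (<⇒≤ (toℕ<n b))) ⟩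
    (toℕ a + h) mod h                      ≡⟨ toℕ+h-mod a ⟩
    a                                      ∎
    where open ≡-Reasoning

  ⊕-⊖ : ∀ a b → a ⊕ b ⊖ b ≡ a
  ⊕-⊖ a b = begin
    a ⊕ b ⊖ b                              ≡⟨ mod-+ _ (h ∸ toℕ b) ⟩
    (toℕ a + toℕ b + (h ∸ toℕ b)) mod h    ≡⟨ cong (_mod h) (+-assoc (toℕ a) _ _) ⟩
    (toℕ a + (toℕ b + (h ∸ toℕ b))) mod h  ≡⟨ cong (λ x → (toℕ a + x) mod h) (m+[n∸m]≡n (<⇒≤ (toℕ<n b))) ⟩
    (toℕ a + h) mod h                      ≡⟨ toℕ+h-mod a ⟩
    a                                      ∎
    where open ≡-Reasoning

-- Multiplying the group size

module Inflation (g h : ℕ) .{{_ : NonZero h}} where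

  project : Partial (Fin (g * h)) n → Partial (Fin g) n
  project = Vec.map (Maybe.map (quotient h))

  part : Fin (g * h) → Fin h
  part = remainder {g} h

  total : Partial (Fin (g * h)) n → Fin h
  total []            = 0 mod h
  total (nothing ∷ u) = total u
  total (just a  ∷ u) = part a ⊕ total u

  weight-project : (u : Partial (Fin (g * h)) n) → weight (project u) ≡ weight u
  weight-project []            = refl
  weight-project (nothing ∷ u) = weight-project u
  weight-project (just _  ∷ u) = cong suc (weight-project u)

  project-⋖ : {u v : Partial (Fin (g * h)) n} → u ⋖ v → project u ⋖ project v
  project-⋖ new        = new
  project-⋖ (keep u⋖v) = keep (project-⋖ u⋖v)

  -- The projection `v` already fixes the group and the quotient of the new point. Only its residue
  -- is free, and the prescribed total determines it by subtraction.
  lift-⋖ : (u : Partial (Fin (g * h)) n) {v : Partial (Fin g) n} → project u ⋖ v → ∀ s →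
           ∃! _≡_ λ w → u ⋖ w × project w ≡ v × total w ≡ s
  lift-⋖ (nothing ∷ u) (new {a = q}) s =
    just (combine q r) ∷ u ,
    (new , cong (λ x → just (proj₁ x) ∷ _) (remQuot-combine q r) ,
     trans (cong (λ x → proj₂ x ⊕ total u) (remQuot-combine q r)) (⊖-⊕ s (total u))) ,
    λ { (new {a = a} , p≡ , t≡) → cong (λ x → just x ∷ u) (trans
          (cong₂ combine (sym (just-injective (∷-injectiveˡ p≡)))
                         (trans (cong (_⊖ total u) (sym t≡)) (⊕-⊖ (part a) (total u))))
          (combine-remQuot {g} h a))
      ; (keep _ , () , _) }
    where r = s ⊖ total u
  lift-⋖ (nothing ∷ u) (keep u⋖v) s
    with w , (u⋖w , p≡ , t≡) , unique ← lift-⋖ u u⋖v s =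
    nothing ∷ w , (keep u⋖w , cong (nothing ∷_) p≡ , t≡) ,
    λ { (new , () , _)
      ; (keep u⋖w′ , p≡′ , t≡′) → cong (nothing ∷_) (unique (u⋖w′ , ∷-injectiveʳ p≡′ , t≡′)) }
  lift-⋖ (just a ∷ u) (keep u⋖v) s
    -- The residue of `a` is already spent, so the remaining groups must sum to `s ⊖ part a`.
    with w , (u⋖w , p≡ , t≡) , unique ← lift-⋖ u u⋖v (s ⊖ part a) =
    just a ∷ w ,
    (keep u⋖w , cong (just _ ∷_) p≡ ,
     trans (⊕-comm (part a) (total w)) (trans (cong (_⊕ part a) t≡) (⊖-⊕ s (part a)))) ,
    λ { (keep {v = w′} u⋖w′ , p≡′ , t≡′) → cong (just a ∷_) (unique
          (u⋖w′ , ∷-injectiveʳ p≡′ ,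
           trans (sym (⊕-⊖ (total w′) (part a)))
                 (cong (_⊖ part a) (trans (⊕-comm (total w′) (part a)) t≡′)))) }

  inflate : (Partial (Fin g) n → Fin k) → Partial (Fin (g * h)) n → Fin (k * h)
  inflate c v = combine (c (project v)) (total v)

  -- A new colour is a pair of an old colour and a residue. The old colour selects one extension of
  -- `project u`, and the residue selects one lift of it above `u`.
  inflate-balanced : {c : Partial (Fin g) n → Fin k} → Balanced t c → Balanced t (inflate c)
  inflate-balanced {k = k} {c = c} bal u wu i
    with v , (u⋖v , cv) , unique-v ← bal (project u) (trans (weight-project u) wu) (quotient h i)
    with w , (u⋖w , p≡ , t≡) , unique-w ← lift-⋖ u u⋖v (remainder {k} h i) =
    w , (u⋖w , trans (cong₂ combine (trans (cong c p≡) cv) t≡) (combine-remQuot {k} h i)) ,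
    λ {w′} (u⋖w′ , eq) →
      let rq = trans (sym (remQuot-combine (c (project w′)) (total w′))) (cong (remQuot {k} h) eq)
      in unique-w (u⋖w′ , sym (unique-v (project-⋖ u⋖w′ , cong proj₁ rq)) , cong proj₂ rq)

-- From colourings to large sets

∣++∣ : (p : Subset m) (q : Subset n) → ∣ p ++ q ∣ ≡ ∣ p ∣ + ∣ q ∣
∣++∣ []            q = refl
∣++∣ (outside ∷ p) q = ∣++∣ p q
∣++∣ (inside  ∷ p) q = cong suc (∣++∣ p q)

∣++∩++∣ : (p p′ : Subset m) (q q′ : Subset n) →
          ∣ (p ++ q) ∩ (p′ ++ q′) ∣ ≡ ∣ p ∩ p′ ∣ + ∣ q ∩ q′ ∣
∣++∩++∣ p p′ q q′ = trans (cong ∣_∣ (zipWith-++ _ p q p′ q′)) (∣++∣ (p ∩ p′) (q ∩ q′))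

∣p∩⊥∣≡0 : (p : Subset n) → ∣ p ∩ ⊥ ∣ ≡ 0
∣p∩⊥∣≡0 {n} p = trans (cong ∣_∣ (∩-zeroʳ p)) (∣⊥∣≡0 n)

++-⊆⁺ : (p p′ : Subset m) {q q′ : Subset n} → p ⊆ p′ → q ⊆ q′ → p ++ q ⊆ p′ ++ q′
++-⊆⁺ []      []       p⊆ q⊆ x∈         = q⊆ x∈
++-⊆⁺ (_ ∷ p) (_ ∷ p′) p⊆ q⊆ here       with here ← p⊆ here = here
++-⊆⁺ (_ ∷ p) (_ ∷ p′) p⊆ q⊆ (there x∈) = there (++-⊆⁺ p p′ (drop-∷-⊆ p⊆) q⊆ x∈)

++-⊆⁻ : (p p′ : Subset m) {q q′ : Subset n} → p ++ q ⊆ p′ ++ q′ → p ⊆ p′ × q ⊆ q′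
++-⊆⁻ []      []       pq⊆ = (λ ()) , pq⊆
++-⊆⁻ (_ ∷ p) (_ ∷ p′) pq⊆ with p⊆ , q⊆ ← ++-⊆⁻ p p′ (drop-∷-⊆ pq⊆) =
  (λ { here → case pq⊆ here of λ { here → here } ; (there x∈) → there (p⊆ x∈) }) , q⊆

∣p∣≡0⇒p≡⊥ : (p : Subset n) → ∣ p ∣ ≡ 0 → p ≡ ⊥
∣p∣≡0⇒p≡⊥ []            _  = refl
∣p∣≡0⇒p≡⊥ (outside ∷ p) eq = cong (outside ∷_) (∣p∣≡0⇒p≡⊥ p eq)

-- The groups as intervals of consecutive points

group : ∀ n g → Fin n → Subset (n * g)
group (suc n) g zero    = ⊤ {g} ++ ⊥
group (suc n) g (suc j) = ⊥ {g} ++ group n g j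

∣group∣ : ∀ n g j → ∣ group n g j ∣ ≡ g
∣group∣ (suc n) g zero    = trans (∣++∣ (⊤ {g}) ⊥)
  (trans (cong₂ _+_ (∣⊤∣≡n g) (∣⊥∣≡0 (n * g))) (+-identityʳ g))
∣group∣ (suc n) g (suc j) = trans (∣++∣ (⊥ {g}) (group n g j))
  (cong₂ _+_ (∣⊥∣≡0 g) (∣group∣ n g j))

-- Stated as a Boolean equation so that both directions of group membership follow from it.
lookup-group : (i j : Fin n) (a : Fin g) →
               Vec.lookup (group n g j) (combine i a) ≡ does (i Fin.≟ j)
lookup-group {suc n} {g} zero    zero    a =
  trans (lookup-++ˡ (⊤ {g}) (⊥ {n * g}) a) (lookup-replicate a true)
lookup-group {suc n} {g} zero    (suc j) a =
  trans (lookup-++ˡ (⊥ {g}) (group n g j) a) (lookup-replicate a false)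
lookup-group {suc n} {g} (suc i) zero    a =
  trans (lookup-++ʳ (⊤ {g}) (⊥ {n * g}) (combine i a)) (lookup-replicate (combine i a) false)
lookup-group {suc n} {g} (suc i) (suc j) a =
  trans (lookup-++ʳ (⊥ {g}) (group n g j) (combine i a)) (lookup-group i j a)

∈-group⁺ : (j : Fin n) (a : Fin g) → combine j a ∈ group n g j
∈-group⁺ j a = lookup⇒[]= _ _ (trans (lookup-group j j a) (dec-true (j Fin.≟ j) refl))

∈-group⁻ : (i j : Fin n) (a : Fin g) → combine i a ∈ group n g j → i ≡ j
∈-group⁻ i j a x∈ with i Fin.≟ j | lookup-group i j a
... | yes eq | _  = eq
... | no  _  | eq = contradiction (trans (sym ([]=⇒lookup x∈)) eq) λ ()

-- The argument of type `Fin g` supplies a point in each group. Disjointness holds because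
-- `quotient` recovers the group from the point.
isGrouping : Fin g → IsGrouping g (group n g)
isGrouping {g} {n} a = record
  { nonempty = λ j → combine j a , ∈-group⁺ j a
  ; included = λ _ _ → _
  ; covering = λ {x} _ → quotient {n} g x ,
      subst (_∈ group n g (quotient g x)) (combine-remQuot {n} g x)
            (∈-group⁺ (quotient {n} g x) (remainder {n} g x))
  ; disjoint = λ {_} {_} {x} p q → trans (sym (index x p)) (index x q)
  } , ∣group∣ n g
  where
  index : ∀ x {j} → x ∈ group n g j → quotient {n} g x ≡ j
  index x {j} x∈ = ∈-group⁻ (quotient {n} g x) j (remainder {n} g x)
    (subst (_∈ group n g j) (sym (combine-remQuot {n} g x)) x∈)

∣∩group-zero∣ : ∀ n (p : Subset g) (q : Subset (n * g)) → ∣ (p ++ q) ∩ group (suc n) g zero ∣ ≡ ∣ p ∣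
∣∩group-zero∣ n p q = trans (∣++∩++∣ p ⊤ q ⊥)
  (trans (cong₂ _+_ (cong ∣_∣ (∩-identityʳ p)) (∣p∩⊥∣≡0 q)) (+-identityʳ _))

∣∩group-suc∣ : (p : Subset g) (q : Subset (n * g)) (j : Fin n) →
               ∣ (p ++ q) ∩ group (suc n) g (suc j) ∣ ≡ ∣ q ∩ group n g j ∣
∣∩group-suc∣ p q j = trans (∣++∩++∣ p ⊥ q (group _ _ j))
  (cong (_+ ∣ q ∩ group _ _ j ∣) (∣p∩⊥∣≡0 p))

-- Partial choices as transverse subsets

cell : Maybe (Fin g) → Subset g
cell = maybe ⁅_⁆ ⊥

∣cell∣≤1 : (x : Maybe (Fin g)) → ∣ cell x ∣ ≤ 1
∣cell∣≤1 {g} nothing = ≤-trans (≤-reflexive (∣⊥∣≡0 g)) z≤n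
∣cell∣≤1 (just a)    = ≤-reflexive (∣⁅x⁆∣≡1 a)

cell-surjective : (p : Subset g) → ∣ p ∣ ≤ 1 → ∃ λ x → cell x ≡ p
cell-surjective []            _ = nothing , refl
cell-surjective (outside ∷ p) ≤1 with cell-surjective p ≤1
... | nothing , refl = nothing , refl
... | just a  , refl = just (suc a) , refl
cell-surjective (inside ∷ p) (s≤s ≤0) =
  just zero , cong (inside ∷_) (sym (∣p∣≡0⇒p≡⊥ p (ℕ.n≤0⇒n≡0 ≤0)))

encode : Partial (Fin g) n → Subset (n * g)
encode []      = []
encode (x ∷ u) = cell x ++ encode u

∣encode∣ : (u : Partial (Fin g) n) → ∣ encode u ∣ ≡ weight u
∣encode∣ []                = refl
∣encode∣ {g} (nothing ∷ u) = trans (∣++∣ (⊥ {g}) (encode u)) (cong₂ _+_ (∣⊥∣≡0 g) (∣encode∣ u))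
∣encode∣ (just a ∷ u)      = trans (∣++∣ ⁅ a ⁆ (encode u)) (cong₂ _+_ (∣⁅x⁆∣≡1 a) (∣encode∣ u))

∣encode∩group∣≤1 : (u : Partial (Fin g) n) → ∀ j → ∣ encode u ∩ group n g j ∣ ≤ 1
∣encode∩group∣≤1 {n = suc n} (x ∷ u) zero    =
  ≤-trans (≤-reflexive (∣∩group-zero∣ n (cell x) (encode u))) (∣cell∣≤1 x)
∣encode∩group∣≤1             (x ∷ u) (suc j) =
  ≤-trans (≤-reflexive (∣∩group-suc∣ (cell x) (encode u) j)) (∣encode∩group∣≤1 u j)

-- Split off the first interval of `g` points: it meets its group at most once, so it is a `cell`,
-- and the rest satisfies the same hypothesis for the remaining groups.
encode-surjective : ∀ n g (s : Subset (n * g)) → (∀ j → ∣ s ∩ group n g j ∣ ≤ 1) →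
                    ∃ λ (u : Partial (Fin g) n) → encode u ≡ s
encode-surjective zero    g [] _  = [] , refl
encode-surjective (suc n) g s  ≤1
  with p , q , refl ← Vec.splitAt g s
  with x , refl ← cell-surjective p
                    (≤-trans (≤-reflexive (sym (∣∩group-zero∣ n p q))) (≤1 zero))
  with u , refl ← encode-surjective n g q
                    (λ j → ≤-trans (≤-reflexive (sym (∣∩group-suc∣ p q j))) (≤1 (suc j)))
  = x ∷ u , refl

⋖⇒⊆ : {u v : Partial (Fin g) n} → u ⋖ v → encode u ⊆ encode v
⋖⇒⊆ (new {a = a})      = ++-⊆⁺ ⊥ ⁅ a ⁆ (⊆-min ⁅ a ⁆) ⊆-refl
⋖⇒⊆ (keep {x = x} u⋖v) = ++-⊆⁺ (cell x) (cell x) ⊆-refl (⋖⇒⊆ u⋖v)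

⊆⇒weight≤ : (u v : Partial (Fin g) n) → encode u ⊆ encode v → weight u ≤ weight v
⊆⇒weight≤ u v u⊆v = subst₂ _≤_ (∣encode∣ u) (∣encode∣ v) (p⊆q⇒∣p∣≤∣q∣ u⊆v)

⁅⁆-⊆⁻ : {a b : Fin g} → ⁅ a ⁆ ⊆ ⁅ b ⁆ → a ≡ b
⁅⁆-⊆⁻ {a = a} {b} a⊆b = x∈⁅y⁆⇒x≡y b (a⊆b (x∈⁅x⁆ a))

⊆∧weight≡⇒≡ : (u v : Partial (Fin g) n) → encode u ⊆ encode v → weight u ≡ weight v → u ≡ v
⊆∧weight≡⇒≡ []      []      _   _  = refl
⊆∧weight≡⇒≡ (x ∷ u) (y ∷ v) u⊆v eq with x⊆y , u⊆v′ ← ++-⊆⁻ (cell x) (cell y) u⊆v with x | y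
... | nothing | nothing = cong (nothing ∷_) (⊆∧weight≡⇒≡ u v u⊆v′ eq)
-- Here the tail of `u` lies inside the tail of `v` and yet would weigh one more.
... | nothing | just _  = contradiction (≤-trans (≤-reflexive (sym eq)) (⊆⇒weight≤ u v u⊆v′)) 1+n≰n
... | just a  | nothing = contradiction (x⊆y (x∈⁅x⁆ a)) ∉⊥
... | just _  | just _  =
  cong₂ _∷_ (cong just (⁅⁆-⊆⁻ x⊆y)) (⊆∧weight≡⇒≡ u v u⊆v′ (suc-injective eq))

-- Converse of `⋖⇒⊆`: the first group where `v` is defined and `u` is not uses up the one extra
-- point, so the tails coincide from there on.
⊆⇒⋖ : (u v : Partial (Fin g) n) → encode u ⊆ encode v → weight v ≡ suc (weight u) → u ⋖ v
⊆⇒⋖ (x ∷ u) (y ∷ v) u⊆v eq with x⊆y , u⊆v′ ← ++-⊆⁻ (cell x) (cell y) u⊆v with x | y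
... | nothing | nothing = keep (⊆⇒⋖ u v u⊆v′ eq)
... | nothing | just _  with refl ← ⊆∧weight≡⇒≡ u v u⊆v′ (sym (suc-injective eq)) = new
... | just a  | nothing = contradiction (x⊆y (x∈⁅x⁆ a)) ∉⊥
... | just _  | just _  with refl ← ⁅⁆-⊆⁻ x⊆y = keep (⊆⇒⋖ u v u⊆v′ (suc-injective eq))

encode-injective : (u v : Partial (Fin g) n) → encode u ≡ encode v → u ≡ v
encode-injective u v eq = ⊆∧weight≡⇒≡ u v (⊆-reflexive eq)
  (trans (sym (∣encode∣ u)) (trans (cong ∣_∣ eq) (∣encode∣ v)))

-- The designs are the colour classes. They partition the transverse sets because `encode` is a
-- bijection onto them, and balancedness becomes the design property because `⋖` corresponds to
-- inclusion between consecutive weights.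
balanced⇒LH : {c : Partial (Fin g) n → Fin k} → Fin g → t ≤ n → Balanced t c → LH n g (suc t) t
balanced⇒LH {g} {n} {k} {t} {c} a t≤n bal = record
  { groups    = group n g
  ; grouping  = isGrouping a
  ; size      = k
  ; design    = Design
  ; partition = record
    { nonempty = nonempty
    ; included = λ _ → included
    ; covering = covering
    ; disjoint = λ (v , _ , cv , ev) (v′ , _ , cv′ , ev′) →
        trans (sym cv) (trans (cong c (encode-injective v v′ (trans ev (sym ev′)))) cv′)
    }
  ; isHDesign = λ i → record
    { grouping = isGrouping a
    ; blocks   = included
    ; balanced = balanced i
    }
  }
  where
  Design : Fin k → Pred (Subset (n * g)) _
  Design i s = ∃ λ v → weight v ≡ suc t × c v ≡ i × encode v ≡ s

  included : ∀ {i s} → Design i s → Transverse (group n g) (suc t) s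
  included (v , wv , _ , refl) = trans (∣encode∣ v) wv , ∣encode∩group∣≤1 v

  covering : ∀ {s} → Transverse (group n g) (suc t) s → ∃ λ i → Design i s
  covering {s} (∣s∣ , ≤1) with v , refl ← encode-surjective n g s ≤1 =
    c v , v , trans (sym (∣encode∣ v)) ∣s∣ , refl , refl

  nonempty : ∀ i → ∃ (Design i)
  nonempty i with u , wu ← ofWeight a t≤n with v , (u⋖v , cv) , _ ← bal u wu i =
    encode v , v , trans (⋖⇒weight u⋖v) (cong suc wu) , cv , refl

  balanced : ∀ i {s} → Transverse (group n g) t s → ∃! _≡_ λ b → Design i b × s ⊆ b
  balanced i {s} (∣s∣ , ≤1)
    with u , refl ← encode-surjective n g s ≤1
    with wu ← trans (sym (∣encode∣ u)) ∣s∣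
    with v , (u⋖v , cv) , unique ← bal u wu i =
    encode v , ((v , trans (⋖⇒weight u⋖v) (cong suc wu) , cv , refl) , ⋖⇒⊆ u⋖v) ,
    λ { ((w , ww , cw , refl) , u⊆w) →
        cong encode (unique (⊆⇒⋖ u w u⊆w (trans ww (cong suc (sym wu))) , cw)) }

balanced⇒LH-multiple : {c : Partial (Fin g) n → Fin k} → Fin g → t ≤ n → Balanced t c →
                       ∀ h .{{_ : NonZero h}} → LH n (g * h) (suc t) t
balanced⇒LH-multiple a t≤n bal h =
  balanced⇒LH (combine a (0 mod h)) t≤n (Inflation.inflate-balanced _ h bal)

-- Deciding balancedness

covers : Partial (Fin g) n → List (Partial (Fin g) n)
covers []            = []
covers (nothing ∷ u) = List.map (λ a → just a ∷ u) (allFin _) List.++ List.map (nothing ∷_) (covers u)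
covers (just a  ∷ u) = List.map (just a ∷_) (covers u)

∈-covers⁺ : {u v : Partial (Fin g) n} → u ⋖ v → v List.∈ covers u
∈-covers⁺ (new {a = a})            = ∈-++⁺ˡ (∈-map⁺ _ (∈-allFin a))
∈-covers⁺ (keep {x = nothing} u⋖v) = ∈-++⁺ʳ _ (∈-map⁺ _ (∈-covers⁺ u⋖v))
∈-covers⁺ (keep {x = just _}  u⋖v) = ∈-map⁺ _ (∈-covers⁺ u⋖v)

∈-covers⁻ : (u : Partial (Fin g) n) {v : Partial (Fin g) n} → v List.∈ covers u → u ⋖ v
∈-covers⁻ (nothing ∷ u) v∈ with ∈-++⁻ (List.map (λ a → just a ∷ u) (allFin _)) v∈
... | inj₁ p with _ , _ , refl ← ∈-map⁻ (λ a → just a ∷ u) p = new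
... | inj₂ p with _ , q , refl ← ∈-map⁻ (nothing ∷_) p = keep (∈-covers⁻ u q)
∈-covers⁻ (just a ∷ u) v∈ with _ , q , refl ← ∈-map⁻ (just a ∷_) v∈ = keep (∈-covers⁻ u q)

length≡1⇒∃! : {xs : List A} → length xs ≡ 1 → ∃! _≡_ (List._∈ xs)
length≡1⇒∃! {xs = x ∷ []} _ = x , here refl , λ { (here eq) → sym eq }

count : (Partial (Fin g) n → Fin k) → Partial (Fin g) n → Fin k → ℕ
count c u i = length (filter (λ v → c v Fin.≟ i) (covers u))

-- Turns unique existence into an equation between numbers that can be evaluated: `covers u` lists
-- exactly the one-point extensions of `u`.
count≡1⇒∃! : (c : Partial (Fin g) n → Fin k) (u : Partial (Fin g) n) (i : Fin k) →
             count c u i ≡ 1 → ∃! _≡_ λ v → u ⋖ v × c v ≡ i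
count≡1⇒∃! c u i eq
  with v , v∈ , unique ← length≡1⇒∃! eq
  with v∈u , cv ← ∈-filter⁻ (λ v → c v Fin.≟ i) {xs = covers u} v∈ =
  v , (∈-covers⁻ u v∈u , cv) ,
  λ (u⋖w , cw) → unique (∈-filter⁺ (λ v → c v Fin.≟ i) (∈-covers⁺ u⋖w) cw)

allPartial? : ∀ {p} {P : Pred (Partial (Fin g) n) p} → Decidable P → Dec (∀ u → P u)
allPartial? {n = zero}  P? = map′ (λ p → λ { [] → p }) (λ p → p []) (P? [])
allPartial? {n = suc n} P? =
  map′ (λ (p , q) → λ { (nothing ∷ u) → p u ; (just a ∷ u) → q a u })
       (λ p → (λ u → p (nothing ∷ u)) , λ a u → p (just a ∷ u))
       (allPartial? (λ u → P? (nothing ∷ u)) ×-dec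
        Fin.all? λ a → allPartial? λ u → P? (just a ∷ u))

counts? : ∀ t (c : Partial (Fin g) n → Fin k) → Dec (∀ u → weight u ≡ t → ∀ i → count c u i ≡ 1)
counts? t c = allPartial? λ u → (weight u ℕ.≟ t) →-dec Fin.all? λ i → count c u i ℕ.≟ 1

-- The base colourings

-- The position of a partial choice of weight w among the (n C w) * g ^ w ones, those
-- that are undefined at the first group coming first.
rank : ℕ → Partial (Fin g) n → ℕ
rank             w       []            = 0
rank             w       (nothing ∷ u) = rank w u
rank             zero    (just _ ∷ u)  = 0
rank {g} {suc n} (suc w) (just a ∷ u)  =
  (n C suc w) * g ^ suc w + toℕ a * ((n C w) * g ^ w) + rank w u

at : List ℕ → ℕ → ℕ
at []       _       = 0
at (x ∷ xs) zero    = x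
at (x ∷ xs) (suc i) = at xs i

-- Each row packs d entries as hexadecimal digits, the last digit being the first entry.
entry : ∀ d → .{{NonZero d}} → List ℕ → ℕ → ℕ
entry d rows i = at rows (i / d) / 16 ^ (i % d) % 16
  where instance _ = m^n≢0 16 (i % d)

-- The tables were found by exact cover searches that prescribe a group of symmetries
-- acting simultaneously on points and colours; its order is 80, 9 and 21 respectively.
rows₅ rows₆ rows₇ : List ℕ
rows₅ =
  0x72501643613427052705613416437250346105275072431650724316346105271643725027056134 ∷
  0x72501643613427054316507205273461613427057250164305273461431650724316507205273461 ∷
  0x27056134164372501643725027056134507243163461052705273461431650726134270572501643 ∷
  0x42537016352461071670534207612435610735247016425324350761534216703461052750724316 ∷
  0x26401735620435175041415026737326620453712640715337512640731540260514140562373762 ∷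
  0x73262673415050411573264051374026402653710462715337626237140505147315046237516204 ∷
  0x53421670243507613524610742537016076124351670534204621735402635175137046215736204 ∷
  0x14050514376262373751046273156204620417352640351741505041732626737016425361073524 ∷
  0x40261735046235171573046251376204267373265041415026405371620471537315264037514026 ∷
  0x07612435167053423524610742537016513726401573402604625371402671536237376205141405 ∷
  0x15734026513726404026715304625371623737620514140553421670243507617016425361073524 ∷
  0x37514026731526401405051437626237046235174026173551376204157304622673732650414150 ∷
  0x61073524701642537315620437510462264035176204173541505041732626736204715326405371 ∷
  0x15736204513704627326267341505041167053420761243542537016352461072435076153421670 ∷
  0x50414150267373265137402615732640046271534026537137626237140505144026351704621735 ∷
  0x26407153620453717315402637512640051414056237376237516204731504626204351726401735 ∷ []
rows₆ =
  0x701824653162475380518046237547038216604723851482365170372185460536017248803621754 ∷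
  0x328654264175712538061840307573048845601156370427263812180516721753382036246704485 ∷
  0x108236063724740182645358571854462047217801165360537823630472407218081623835157564 ∷
  0x238603375470548624651172018271385832546426751073610408615703357480584016128274632 ∷
  0x458160561037735804326281742074821810362306247715456583642517127853283465084730106 ∷
  0x853470182537048721356612064465801236485601238710574327623247182048160703175853546 ∷
  0x835162740106475283274380156704365651824823017502431678517036724651370462284308815 ∷
  0x180754375216462380867025431408653127263701845715824063036518548372217604431786250 ∷
  0x037624751360472516158842083465751538821236472037480601281046573645237108307518642 ∷
  0x246803018547537162314678250804217385704218375640563126160382546018623854273107745 ∷
  0x610547832427038561583216407382170470653165248786025314564723081730851426128604735 ∷
  0x016370804385654517724218362326170458571482630840365271721046603185854723502314867 ∷
  0x362548016823654180457732071247165703246175603830581428821753480172538047261406635 ∷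
  0x753621624038801475502143786157248306084536712632017584485237172460360851678025143 ∷
  0x742803615358621074061754328516482238701047536143867250073185264812460357456372810 ∷ []
rows₇ =
  0x01732564450725460137136267205143642573015470731064523126435120671236361205747405 ∷
  0x53142672605443017610327572061353410720641546753232404075675116325761204356170324 ∷
  0x60723114537034526725041614356260274502375173160457041657204340233216675171654230 ∷
  0x21365036740557144072263105213647506316723214074545670743712462511320421730036556 ∷
  0x42031567715643203260157506342146740153727165024342306751165302043576742521371460 ∷
  0x47631205472116353206705436124721057457064035621370515420036531672643563024421771 ∷
  0x56712043034276512341765714026310056435270324516756173420612734407215057363524106 ∷ []

-- The choices of weight 4 number 5 * 4 ^ 4 = 16 * 80 here, and 15 * 3 ^ 4 = 15 * 81 and 35 * 2 ^ 4
-- = 7 * 80 in the next two cases: rows times entries per row.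
colour₅ : Partial (Fin 4) 5 → Fin 8
colour₅ v = entry 80 rows₅ (rank 4 v) mod 8

colour₆ : Partial (Fin 3) 6 → Fin 9
colour₆ v = entry 81 rows₆ (rank 4 v) mod 9

colour₇ : Partial (Fin 2) 7 → Fin 8
colour₇ v = entry 80 rows₇ (rank 4 v) mod 8

-- Proved by exhaustive evaluation, as are the next two: `counts?` runs through all choices of
-- weight 3, here 10 * 4 ^ 3 = 640 of them, and all colours.
balanced₅ : Balanced 3 colour₅
balanced₅ u wu i = count≡1⇒∃! colour₅ u i (toWitness {a? = counts? 3 colour₅} _ u wu i)

balanced₆ : Balanced 3 colour₆
balanced₆ u wu i = count≡1⇒∃! colour₆ u i (toWitness {a? = counts? 3 colour₆} _ u wu i)

balanced₇ : Balanced 3 colour₇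
balanced₇ u wu i = count≡1⇒∃! colour₇ u i (toWitness {a? = counts? 3 colour₇} _ u wu i)

-- Admissible group sizes

∣-cancel : ∀ {p} → Prime p → ∀ g m → ¬ p ∣ m → p ∣ g * m → p ∣ g
∣-cancel pr g m p∤m p∣gm with euclidsLemma g m pr p∣gm
... | inj₁ p∣g = p∣g
... | inj₂ p∣m = contradiction p∣m p∤m

2∣g∧g%4≢2⇒4∣g : 2 ∣ g → ¬ g % 4 ≡ 2 → 4 ∣ g
2∣g∧g%4≢2⇒4∣g (divides q refl) ≢2 with q divMod 2
... | result r zero refl       = divides r (*-assoc r 2 2)
-- An odd `q = 1 + r * 2` gives `g = 2 + r * 4`, the excluded residue.
... | result r (suc zero) refl = contradiction
  (trans (cong (λ x → (2 + x) % 4) (*-assoc r 2 2)) ([m+kn]%n≡m%n 2 r 4)) ≢2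

∣⇒LH : ∀ {d} {c : Partial (Fin d) n → Fin k} → Fin d → t ≤ n → Balanced t c →
       g ≥ 1 → d ∣ g → LH n g (suc t) t
∣⇒LH {n} {t = t} {d = d} a t≤n bal g≥1 (divides h refl) =
  subst (λ g → LH n g (suc t) t) (*-comm d h) (balanced⇒LH-multiple a t≤n bal h)
  -- Positivity of `g = h * d` passes to the cofactor `h`, the modulus of the inflation.
  where instance _ = m*n≢0⇒m≢0 h {{>-nonZero g≥1}}

theorem14 : (n g : ℕ) → n ≡ 5 ⊎ n ≡ 6 ⊎ n ≡ 7 → g ≥ 1 →
    (g * n) % 2 ≡ 0 → (g * (n ∸ 1) * (n ∸ 2)) % 3 ≡ 0 →
    ¬ (n ≡ 5 × g ≡ 2) →
    ¬ (n ≡ 5 × g % 4 ≡ 2) →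
    LH n g 4 3
theorem14 _ g (inj₁ refl) g≥1 even _ _ g%4≢2 =
  -- From `2 ∣ g * 5` the size `g` is even, and excluding residue 2 modulo 4 leaves `4 ∣ g`.
  ∣⇒LH zero (ℕ.m≤m+n 3 2) balanced₅ g≥1
    (2∣g∧g%4≢2⇒4∣g (∣-cancel prime[2] g 5 (from-no (2 ∣? 5)) (m%n≡0⇒n∣m (g * 5) 2 even))
                   λ eq → g%4≢2 (refl , eq))
theorem14 _ g (inj₂ (inj₁ refl)) g≥1 _ triple _ _ =
  ∣⇒LH zero (ℕ.m≤m+n 3 3) balanced₆ g≥1
    -- The factors `n ∸ 1 = 5` and `n ∸ 2 = 4` are prime to 3, so 3 must divide `g`.
    (∣-cancel prime[3] g 5 (from-no (3 ∣? 5))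
      (∣-cancel prime[3] (g * 5) 4 (from-no (3 ∣? 4)) (m%n≡0⇒n∣m (g * 5 * 4) 3 triple)))
  where prime[3] = from-yes (prime? 3)
theorem14 _ g (inj₂ (inj₂ refl)) g≥1 even _ _ _ =
  ∣⇒LH zero (ℕ.m≤m+n 3 4) balanced₇ g≥1
    (∣-cancel prime[2] g 7 (from-no (2 ∣? 7)) (m%n≡0⇒n∣m (g * 7) 2 even))
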